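{- Let $\lambda$ be a nonzero real number. Let $\{T_{n}^{(3)}\}_{n\ge 0}$ be defined by $T_{0}^{(3)}=T_{1}^{(3)}=0$, $T_{2}^{(3)}=1$ and $T_{n+3}^{(3)}=T_{n+2}^{(3)}+3T_{n+1}^{(3)}+9T_{n}^{(3)}$ for $n\ge 0$. Then for all $n\ge 1$, $$T_{n}^{(3)}=\frac{1}{\lambda^{n-2}}H_{n}^{(3)}(0,0,1;\lambda,3\lambda^{2},9\lambda^{3}),$$ where $H_n^{(3)}(a,b,c;r,s,t)$ denotes the $n$-th third-order Horadam number.
   Context: For given numbers $a,b,c,r,s,t$, the third-order Horadam numbers $H_{n}^{(3)}=H_{n}^{(3)}(a,b,c;r,s,t)$, $n\ge 0$, are defined by $H_{0}^{(3)}=a$, $H_{1}^{(3)}=b$, $H_{2}^{(3)}=c$ and $H_{n+3}^{(3)}=rH_{n+2}^{(3)}+sH_{n+1}^{(3)}+tH_{n}^{(3)}$ for $n\ge 0$. The superscript $(3)$ is part of the notation, not an exponent. The exponent $n-2$ is an integer and may be negative. -}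

module Defs where

open import Algebra.Bundles using (CommutativeRing)
open import Algebra.Structures using (IsCommutativeRing)
import Algebra.Properties.Semiring.Exp as Exp
open import Data.Integer.Base as ℤ using (ℤ; +_; -[1+_])
open import Data.Nat.Base as ℕ using (ℕ; zero; suc)
import Data.Nat.Properties as ℕ
open import Data.Product.Base using (∃-syntax; _×_; _,_; proj₁; proj₂)
open import Data.Rational.Base
open import Data.Rational.Properties
open import Data.Rational.Solver using (module +-*-Solver)
open import Data.Unit.Base using (⊤)
open import Function.Base using (_$_)
open import Level using (0ℓ)
open import Relation.Binary.PropositionalEquality
  using (_≡_; refl; sym; trans; cong; cong₂; subst)
open import Relation.Nullary.Decidable using (yes; no)
open import Relation.Nullary.Negation using (contradiction)

open +-*-Solver using (solve; _:+_; _:*_; _:-_; :-_; _:=_; con)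

half : ℚ → ℚ
half ε = ½ * ε

half-pos : ∀ ε .{{_ : Positive ε}} → Positive (half ε)
half-pos ε = pos*pos⇒pos ½ ε

half+half : ∀ ε → half ε + half ε ≡ ε
half+half = solve 1 (λ e → con ½ :* e :+ con ½ :* e := e) refl

-- 1/ p , with the junk value 0 at p = 0.
inv : ℚ → ℚ
inv p with p ≟ 0ℚ
... | yes _   = 0ℚ
... | no  p≢0 = (1/ p) {{≢-nonZero p≢0}}

p*inv-p : ∀ p δ .{{_ : Positive δ}} → δ ≤ ∣ p ∣ → p * inv p ≡ 1ℚ
p*inv-p p δ δ≤∣p∣ with p ≟ 0ℚ
... | no  p≢0  = *-inverseʳ p {{≢-nonZero p≢0}}
... | yes refl = contradiction (<-≤-trans (positive⁻¹ δ) δ≤∣p∣) (<-irrefl refl)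

triangle : ∀ {a b c ε} .{{_ : Positive ε}} →
           ∣ a ∣ < half ε → ∣ b ∣ < half ε → a + b ≡ c → ∣ c ∣ < ε
triangle {a} {b} {ε = ε} a< b< refl = begin-strict
  ∣ a + b ∣         ≤⟨ ∣p+q∣≤∣p∣+∣q∣ a b ⟩
  ∣ a ∣ + ∣ b ∣     <⟨ +-mono-< a< b< ⟩
  half ε + half ε   ≡⟨ half+half ε ⟩
  ε                 ∎
  where open ≤-Reasoning

*-close : ∀ {a b c d B C δ} .{{_ : Positive B}} .{{_ : Positive C}} →
          ∣ a ∣ ≤ B → ∣ d ∣ ≤ C → ∣ b - d ∣ < δ → ∣ a - c ∣ < δ →
          ∣ a * b - c * d ∣ < (B + C) * δ
*-close {a} {b} {c} {d} {B} {C} {δ} a≤ d≤ b-d< a-c< = begin-strict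
  ∣ a * b - c * d ∣
    ≡⟨ cong ∣_∣ (solve 4 (λ a b c d → a :* b :- c :* d :=
                   a :* (b :- d) :+ d :* (a :- c)) refl a b c d) ⟩
  ∣ a * (b - d) + d * (a - c) ∣
    ≤⟨ ∣p+q∣≤∣p∣+∣q∣ (a * (b - d)) (d * (a - c)) ⟩
  ∣ a * (b - d) ∣ + ∣ d * (a - c) ∣
    ≡⟨ cong₂ _+_ (∣p*q∣≡∣p∣*∣q∣ a (b - d)) (∣p*q∣≡∣p∣*∣q∣ d (a - c)) ⟩
  ∣ a ∣ * ∣ b - d ∣ + ∣ d ∣ * ∣ a - c ∣
    ≤⟨ +-mono-≤ (*-monoʳ-≤-nonNeg ∣ b - d ∣ {{∣-∣-nonNeg (b - d)}} a≤)
                (*-monoʳ-≤-nonNeg ∣ a - c ∣ {{∣-∣-nonNeg (a - c)}} d≤) ⟩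
  B * ∣ b - d ∣ + C * ∣ a - c ∣
    <⟨ +-mono-< (*-monoʳ-<-pos B b-d<) (*-monoʳ-<-pos C a-c<) ⟩
  B * δ + C * δ
    ≡⟨ *-distribʳ-+ δ B C ⟨
  (B + C) * δ ∎
  where open ≤-Reasoning

*-apart : ∀ {p q δ δ′} .{{_ : Positive δ}} .{{_ : Positive δ′}} →
          δ ≤ ∣ p ∣ → δ′ ≤ ∣ q ∣ → δ * δ′ ≤ ∣ p * q ∣
*-apart {p} {q} {δ} {δ′} δ≤ δ′≤ = begin
  δ * δ′         ≤⟨ *-monoˡ-≤-nonNeg δ {{pos⇒nonNeg δ}} δ′≤ ⟩
  δ * ∣ q ∣      ≤⟨ *-monoʳ-≤-nonNeg ∣ q ∣ {{∣-∣-nonNeg q}} δ≤ ⟩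
  ∣ p ∣ * ∣ q ∣  ≡⟨ ∣p*q∣≡∣p∣*∣q∣ p q ⟨
  ∣ p * q ∣      ∎
  where open ≤-Reasoning

inv-close : ∀ {p q δ ε} .{{_ : Positive δ}} → δ ≤ ∣ p ∣ → δ ≤ ∣ q ∣ →
            ∣ p - q ∣ < ε * (δ * δ) → ∣ inv p - inv q ∣ < ε
inv-close {p} {q} {δ} {ε} δ≤p δ≤q p-q< =
  *-cancelʳ-<-nonNeg (δ * δ) {{pos⇒nonNeg (δ * δ) {{pos*pos⇒pos δ δ}}}} $ begin-strict
  ∣ inv p - inv q ∣ * (δ * δ)
    ≤⟨ *-monoˡ-≤-nonNeg ∣ inv p - inv q ∣ {{∣-∣-nonNeg (inv p - inv q)}}
         (*-apart {p} {q} δ≤p δ≤q) ⟩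
  ∣ inv p - inv q ∣ * ∣ p * q ∣
    ≡⟨ ∣p*q∣≡∣p∣*∣q∣ (inv p - inv q) (p * q) ⟨
  ∣ (inv p - inv q) * (p * q) ∣
    ≡⟨ cong ∣_∣ (solve 4 (λ p q p′ q′ → (p′ :- q′) :* (p :* q) :=
                   q :* (p :* p′) :- p :* (q :* q′)) refl p q (inv p) (inv q)) ⟩
  ∣ q * (p * inv p) - p * (q * inv q) ∣
    ≡⟨ cong₂ (λ u v → ∣ q * u - p * v ∣) (p*inv-p p δ δ≤p) (p*inv-p q δ δ≤q) ⟩
  ∣ q * 1ℚ - p * 1ℚ ∣
    ≡⟨ cong ∣_∣ (solve 2 (λ p q → q :* con 1ℚ :- p :* con 1ℚ := :- (p :- q)) refl p q) ⟩
  ∣ - (p - q) ∣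
    ≡⟨ ∣-p∣≡∣p∣ (p - q) ⟩
  ∣ p - q ∣
    <⟨ p-q< ⟩
  ε * (δ * δ) ∎
  where open ≤-Reasoning

inv-apart : ∀ {p B δ} (B>0 : Positive B) → Positive δ → δ ≤ ∣ p ∣ → ∣ p ∣ ≤ B →
            (1/ B) {{pos⇒nonZero B {{B>0}}}} ≤ ∣ inv p ∣
inv-apart {p} {B} {δ} B>0 δ>0 δ≤ ≤B = *-cancelˡ-≤-pos B {{B>0}} $ begin
  B * 1/B            ≡⟨ *-inverseʳ B {{pos⇒nonZero B {{B>0}}}} ⟩
  ∣ 1ℚ ∣             ≡⟨ cong ∣_∣ (p*inv-p p δ {{δ>0}} δ≤) ⟨
  ∣ p * inv p ∣      ≡⟨ ∣p*q∣≡∣p∣*∣q∣ p (inv p) ⟩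
  ∣ p ∣ * ∣ inv p ∣  ≤⟨ *-monoʳ-≤-nonNeg ∣ inv p ∣ {{∣-∣-nonNeg (inv p)}} ≤B ⟩
  B * ∣ inv p ∣      ∎
  where
  open ≤-Reasoning
  1/B = (1/ B) {{pos⇒nonZero B {{B>0}}}}

Cauchy : (ℕ → ℚ) → Set
Cauchy f = ∀ ε .{{_ : Positive ε}} →
           ∃[ N ] ∀ m n → N ℕ.≤ m → N ℕ.≤ n → ∣ f m - f n ∣ < ε

-- Cantor's construction: Cauchy sequences of rationals, equal (_≈_) when
-- their difference tends to 0.
record ℝ : Set where
  constructor mkℝ
  field
    seq    : ℕ → ℚ
    cauchy : Cauchy seq

open ℝ public

infix 4 _≈_ _#_

_≈_ : ℝ → ℝ → Set
x ≈ y = ∀ ε .{{_ : Positive ε}} →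
        ∃[ N ] ∀ n → N ℕ.≤ n → ∣ seq x n - seq y n ∣ < ε

-- Apartness: the positive form of inequality, classically equivalent to
-- the negation of _≈_ , and constructively what is needed in order to divide.
_#_ : ℝ → ℝ → Set
x # y = ∃[ δ ] Positive δ × ∃[ N ] ∀ n → N ℕ.≤ n → δ ≤ ∣ seq x n - seq y n ∣

-- The Cauchy proofs are abstract only to keep the type checker from
-- unfolding them when it compares reals.
abstract
  constant-cauchy : ∀ q → Cauchy (λ _ → q)
  constant-cauchy q ε = 0 , λ _ _ _ _ →
    subst (_< ε) (sym (cong ∣_∣ (+-inverseʳ q))) (positive⁻¹ ε)

fromℚ : ℚ → ℝ
fromℚ q = mkℝ (λ _ → q) (constant-cauchy q)

fromℕ : ℕ → ℝ
fromℕ n = fromℚ (+ n / 1)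

0ℝ 1ℝ : ℝ
0ℝ = fromℚ 0ℚ
1ℝ = fromℚ 1ℚ

module _ {M N k : ℕ} (M⊔N≤k : M ℕ.⊔ N ℕ.≤ k) where
  ⊔≤₁ : M ℕ.≤ k
  ⊔≤₁ = ℕ.≤-trans (ℕ.m≤m⊔n M N) M⊔N≤k

  ⊔≤₂ : N ℕ.≤ k
  ⊔≤₂ = ℕ.≤-trans (ℕ.m≤n⊔m M N) M⊔N≤k

EventuallyBounded : (ℕ → ℚ) → Set
EventuallyBounded f = ∃[ B ] Positive B × ∃[ N ] ∀ n → N ℕ.≤ n → ∣ f n ∣ ≤ B

eventually-bounded : ∀ x → EventuallyBounded (seq x)
eventually-bounded x with cauchy x 1ℚ
... | N , close = 1ℚ + ∣ a ∣
                , positive (+-mono-<-≤ (positive⁻¹ 1ℚ) (0≤∣p∣ a))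
                , N , bound
  where
  a = seq x N
  open ≤-Reasoning
  bound : ∀ n → N ℕ.≤ n → ∣ seq x n ∣ ≤ 1ℚ + ∣ a ∣
  bound n N≤n = begin
    ∣ seq x n ∣            ≡⟨ cong ∣_∣ (solve 2 (λ p q → p := (p :- q) :+ q) refl (seq x n) a) ⟩
    ∣ (seq x n - a) + a ∣  ≤⟨ ∣p+q∣≤∣p∣+∣q∣ (seq x n - a) a ⟩
    ∣ seq x n - a ∣ + ∣ a ∣ ≤⟨ +-monoˡ-≤ ∣ a ∣ (<⇒≤ (close n N N≤n ℕ.≤-refl)) ⟩
    1ℚ + ∣ a ∣ ∎

infix  8 -ℝ_
infixl 7 _*ℝ_
infixl 6 _+ℝ_

abstract
  +-cauchy : ∀ x y → Cauchy (λ n → seq x n + seq y n)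
  +-cauchy x y ε with cauchy x (half ε) {{half-pos ε}} | cauchy y (half ε) {{half-pos ε}}
  ... | M , f | N , g = M ℕ.⊔ N , λ m n m≥ n≥ →
    triangle {ε = ε} (f m n (⊔≤₁ m≥) (⊔≤₁ n≥)) (g m n (⊔≤₂ m≥) (⊔≤₂ n≥))
      (solve 4 (λ a b c d → (a :- c) :+ (b :- d) := (a :+ b) :- (c :+ d)) refl
        (seq x m) (seq y m) (seq x n) (seq y n))

_+ℝ_ : ℝ → ℝ → ℝ
x +ℝ y = mkℝ (λ n → seq x n + seq y n) (+-cauchy x y)

-‿close : ∀ {p q ε : ℚ} → ∣ p - q ∣ < ε → ∣ - p - - q ∣ < ε
-‿close {p} {q} {ε} = subst (_< ε) (trans (sym (∣-p∣≡∣p∣ (p - q)))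
  (cong ∣_∣ (solve 2 (λ p q → :- (p :- q) := :- p :- :- q) refl p q)))

abstract
  neg-cauchy : ∀ x → Cauchy (λ n → - seq x n)
  neg-cauchy x ε = let N , f = cauchy x ε in
    N , λ m n m≥ n≥ → -‿close {seq x m} {seq x n} (f m n m≥ n≥)

-ℝ_ : ℝ → ℝ
-ℝ x = mkℝ (λ n → - seq x n) (neg-cauchy x)

scaled-tolerance : ∀ D ε → Positive D → .{{_ : Positive ε}} →
                   ∃[ δ ] Positive δ × D * δ ≡ ε
scaled-tolerance D ε D>0 = 1/ D * ε , pos*pos⇒pos (1/ D) {{1/pos⇒pos D}} ε ,
  trans (sym (*-assoc D (1/ D) ε)) (trans (cong (_* ε) (*-inverseʳ D)) (*-identityˡ ε))
  where
  instance
    D-pos : Positive D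
    D-pos = D>0
    D≢0 : NonZero D
    D≢0 = pos⇒nonZero D

-- Common to the Cauchy property of products and the congruence of _*ℝ_ :
-- R is either the set of all pairs (m , n) or the diagonal.
module _ (R : ℕ → ℕ → Set) where

  Near : (ℕ → ℚ) → (ℕ → ℚ) → ℚ → Set
  Near f g ε = ∃[ N ] ∀ m n → R m n → N ℕ.≤ m → N ℕ.≤ n → ∣ f m - g n ∣ < ε

  *-near : ∀ a b c d → EventuallyBounded a → EventuallyBounded d →
           (∀ ε → .{{_ : Positive ε}} → Near a c ε) →
           (∀ ε → .{{_ : Positive ε}} → Near b d ε) →
           ∀ ε → .{{_ : Positive ε}} → Near (λ n → a n * b n) (λ n → c n * d n) ε
  *-near a b c d (B , B>0 , K , bda) (C , C>0 , L , bdd) a~c b~d ε =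
    choose (scaled-tolerance (B + C) ε (pos+pos⇒pos B {{B>0}} C {{C>0}}))
    where
    combine : ∀ {δ} → (B + C) * δ ≡ ε → Near a c δ → Near b d δ →
              Near (λ n → a n * b n) (λ n → c n * d n) ε
    combine eq (M , f) (N , g) = (K ℕ.⊔ L) ℕ.⊔ (M ℕ.⊔ N) , λ m n r m≥ n≥ →
      subst (∣ a m * b m - c n * d n ∣ <_) eq
        (*-close {a m} {b m} {c n} {d n} {{B>0}} {{C>0}}
          (bda m (⊔≤₁ (⊔≤₁ m≥))) (bdd n (⊔≤₂ {K} (⊔≤₁ n≥)))
          (g m n r (⊔≤₂ {M} (⊔≤₂ {K ℕ.⊔ L} m≥)) (⊔≤₂ {M} (⊔≤₂ {K ℕ.⊔ L} n≥)))
          (f m n r (⊔≤₁ (⊔≤₂ {K ℕ.⊔ L} m≥)) (⊔≤₁ (⊔≤₂ {K ℕ.⊔ L} n≥))))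
    choose : ∃[ δ ] Positive δ × (B + C) * δ ≡ ε →
             Near (λ n → a n * b n) (λ n → c n * d n) ε
    choose (δ , δ>0 , eq) = combine eq (a~c δ {{δ>0}}) (b~d δ {{δ>0}})

abstract
  *-cauchy : ∀ x y → Cauchy (λ n → seq x n * seq y n)
  *-cauchy x y ε =
    let N , f = *-near (λ _ _ → ⊤) (seq x) (seq y) (seq x) (seq y)
                  (eventually-bounded x) (eventually-bounded y)
                  (λ δ → near x δ) (λ δ → near y δ) ε
    in N , λ m n → f m n _
    where
    near : ∀ z δ .{{_ : Positive δ}} → Near (λ _ _ → ⊤) (seq z) (seq z) δ
    near z δ = let N , f = cauchy z δ in N , λ m n _ → f m n

_*ℝ_ : ℝ → ℝ → ℝ
x *ℝ y = mkℝ (λ n → seq x n * seq y n) (*-cauchy x y)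

abstract
  ≗⇒≈ : ∀ x y → (∀ n → seq x n ≡ seq y n) → x ≈ y
  ≗⇒≈ x y eq ε = 0 , λ n _ →
    subst (λ p → ∣ seq x n - p ∣ < ε) (eq n)
      (subst (_< ε) (sym (cong ∣_∣ (+-inverseʳ (seq x n)))) (positive⁻¹ ε))

  ≈-refl : ∀ {x} → x ≈ x
  ≈-refl {x} = ≗⇒≈ x x λ _ → refl

  ≈-sym : ∀ {x y} → x ≈ y → y ≈ x
  ≈-sym {x} {y} x≈y ε = let N , f = x≈y ε in N , λ n n≥ →
    subst (_< ε) (trans (sym (∣-p∣≡∣p∣ (seq x n - seq y n)))
      (cong ∣_∣ (solve 2 (λ p q → :- (p :- q) := q :- p) refl (seq x n) (seq y n))))
      (f n n≥)

  ≈-trans : ∀ {x y z} → x ≈ y → y ≈ z → x ≈ z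
  ≈-trans {x} {y} {z} x≈y y≈z ε
    with x≈y (half ε) {{half-pos ε}} | y≈z (half ε) {{half-pos ε}}
  ... | M , f | N , g = M ℕ.⊔ N , λ n n≥ →
    triangle {ε = ε} (f n (⊔≤₁ n≥)) (g n (⊔≤₂ n≥))
      (solve 3 (λ a b c → (a :- b) :+ (b :- c) := a :- c) refl
        (seq x n) (seq y n) (seq z n))

  +ℝ-cong : ∀ {x y u v} → x ≈ y → u ≈ v → x +ℝ u ≈ y +ℝ v
  +ℝ-cong {x} {y} {u} {v} x≈y u≈v ε
    with x≈y (half ε) {{half-pos ε}} | u≈v (half ε) {{half-pos ε}}
  ... | M , f | N , g = M ℕ.⊔ N , λ n n≥ →
    triangle {ε = ε} (f n (⊔≤₁ n≥)) (g n (⊔≤₂ n≥))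
      (solve 4 (λ a b c d → (a :- c) :+ (b :- d) := (a :+ b) :- (c :+ d)) refl
        (seq x n) (seq u n) (seq y n) (seq v n))

  -ℝ-cong : ∀ {x y} → x ≈ y → -ℝ x ≈ -ℝ y
  -ℝ-cong {x} {y} x≈y ε = let N , f = x≈y ε in
    N , λ n n≥ → -‿close {seq x n} {seq y n} (f n n≥)

  *ℝ-cong : ∀ {x y u v} → x ≈ y → u ≈ v → x *ℝ u ≈ y *ℝ v
  *ℝ-cong {x} {y} {u} {v} x≈y u≈v ε =
    let N , f = *-near _≡_ (seq x) (seq u) (seq y) (seq v)
                  (eventually-bounded x) (eventually-bounded v)
                  (λ δ → near x y x≈y δ) (λ δ → near u v u≈v δ) ε
    in N , λ n n≥ → f n n refl n≥ n≥
    where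
    near : ∀ w z → w ≈ z → ∀ δ .{{_ : Positive δ}} → Near _≡_ (seq w) (seq z) δ
    near w z w≈z δ = let N , f = w≈z δ in N , λ { m .m refl m≥ _ → f m m≥ }

ℝ-isCommutativeRing : IsCommutativeRing _≈_ _+ℝ_ _*ℝ_ -ℝ_ 0ℝ 1ℝ
ℝ-isCommutativeRing = record
  { isRing = record
    { +-isAbelianGroup = record
      { isGroup = record
        { isMonoid = record
          { isSemigroup = record
            { isMagma = record
              { isEquivalence = record
                { refl  = λ {x} → ≈-refl {x}
                ; sym   = λ {x y} → ≈-sym {x} {y}
                ; trans = λ {x y z} → ≈-trans {x} {y} {z}
                }
              ; ∙-cong = λ {x y u v} → +ℝ-cong {x} {y} {u} {v}
              }
            ; assoc = λ x y z → ≗⇒≈ (x +ℝ y +ℝ z) (x +ℝ (y +ℝ z)) λ n →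
                +-assoc (seq x n) (seq y n) (seq z n)
            }
          ; identity = (λ x → ≗⇒≈ (0ℝ +ℝ x) x λ n → +-identityˡ (seq x n))
                     , (λ x → ≗⇒≈ (x +ℝ 0ℝ) x λ n → +-identityʳ (seq x n))
          }
        ; inverse = (λ x → ≗⇒≈ (-ℝ x +ℝ x) 0ℝ λ n → +-inverseˡ (seq x n))
                  , (λ x → ≗⇒≈ (x +ℝ -ℝ x) 0ℝ λ n → +-inverseʳ (seq x n))
        ; ⁻¹-cong = λ {x y} → -ℝ-cong {x} {y}
        }
      ; comm = λ x y → ≗⇒≈ (x +ℝ y) (y +ℝ x) λ n → +-comm (seq x n) (seq y n)
      }
    ; *-cong = λ {x y u v} → *ℝ-cong {x} {y} {u} {v}
    ; *-assoc = λ x y z → ≗⇒≈ (x *ℝ y *ℝ z) (x *ℝ (y *ℝ z)) λ n →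
        *-assoc (seq x n) (seq y n) (seq z n)
    ; *-identity = (λ x → ≗⇒≈ (1ℝ *ℝ x) x λ n → *-identityˡ (seq x n))
                 , (λ x → ≗⇒≈ (x *ℝ 1ℝ) x λ n → *-identityʳ (seq x n))
    ; distrib = (λ x y z → ≗⇒≈ (x *ℝ (y +ℝ z)) (x *ℝ y +ℝ x *ℝ z) λ n →
                  *-distribˡ-+ (seq x n) (seq y n) (seq z n))
              , (λ x y z → ≗⇒≈ ((y +ℝ z) *ℝ x) (y *ℝ x +ℝ z *ℝ x) λ n →
                  *-distribʳ-+ (seq x n) (seq y n) (seq z n))
    }
  ; *-comm = λ x y → ≗⇒≈ (x *ℝ y) (y *ℝ x) λ n → *-comm (seq x n) (seq y n)
  }

ℝ-commutativeRing : CommutativeRing 0ℓ 0ℓ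
ℝ-commutativeRing = record { isCommutativeRing = ℝ-isCommutativeRing }

open Exp (CommutativeRing.semiring ℝ-commutativeRing) public using (_^_)

ℝ≠0 : Set
ℝ≠0 = ∃[ x ] x # 0ℝ

EventuallyAwayFrom0 : (ℕ → ℚ) → Set
EventuallyAwayFrom0 f = ∃[ δ ] Positive δ × ∃[ N ] ∀ n → N ℕ.≤ n → δ ≤ ∣ f n ∣

#0-bound : ∀ {x} → x # 0ℝ → EventuallyAwayFrom0 (seq x)
#0-bound {x} (δ , δ>0 , N , f) = δ , δ>0 , N , λ n n≥ →
  subst (λ p → δ ≤ ∣ p ∣) (+-identityʳ (seq x n)) (f n n≥)

bound-#0 : ∀ {x} → EventuallyAwayFrom0 (seq x) → x # 0ℝ
bound-#0 {x} (δ , δ>0 , N , f) = δ , δ>0 , N , λ n n≥ →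
  subst (λ p → δ ≤ ∣ p ∣) (sym (+-identityʳ (seq x n))) (f n n≥)

abstract
  inv-cauchy : ∀ x → x # 0ℝ → Cauchy (λ n → inv (seq x n))
  inv-cauchy x x#0 ε with #0-bound {x} x#0
  ... | δ , δ>0 , K , ap =
    let N , f = cauchy x (ε * (δ * δ))
                  {{pos*pos⇒pos ε (δ * δ) {{pos*pos⇒pos δ {{δ>0}} δ {{δ>0}}}}}}
    in K ℕ.⊔ N , λ m n m≥ n≥ →
      inv-close {seq x m} {seq x n} {{δ>0}} (ap m (⊔≤₁ m≥)) (ap n (⊔≤₁ n≥))
        (f m n (⊔≤₂ m≥) (⊔≤₂ n≥))

recip : ∀ x → x # 0ℝ → ℝ
recip x x#0 = mkℝ (λ n → inv (seq x n)) (inv-cauchy x x#0)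

abstract
  *-recipʳ : ∀ x (x#0 : x # 0ℝ) → x *ℝ recip x x#0 ≈ 1ℝ
  *-recipʳ x x#0 ε with #0-bound {x} x#0
  ... | δ , δ>0 , N , ap = N , λ n n≥ →
    subst (λ p → ∣ p - 1ℚ ∣ < ε) (sym (p*inv-p (seq x n) δ {{δ>0}} (ap n n≥)))
      (positive⁻¹ ε)

  recip#0 : ∀ x (x#0 : x # 0ℝ) → recip x x#0 # 0ℝ
  recip#0 x x#0 = combine (#0-bound {x} x#0) (eventually-bounded x)
    where
    combine : EventuallyAwayFrom0 (seq x) → EventuallyBounded (seq x) → recip x x#0 # 0ℝ
    combine (δ , δ>0 , M , ap) (B , B>0 , N , bd) = bound-#0 {recip x x#0}
      ( (1/ B) {{pos⇒nonZero B {{B>0}}}} , 1/pos⇒pos B {{B>0}} , M ℕ.⊔ N , λ n n≥ →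
        inv-apart {seq x n} B>0 δ>0 (ap n (⊔≤₁ n≥)) (bd n (⊔≤₂ n≥)))

  1#0 : 1ℝ # 0ℝ
  1#0 = 1ℚ , _ , 0 , λ _ _ → ≤-refl

  *#0 : ∀ x y → x # 0ℝ → y # 0ℝ → x *ℝ y # 0ℝ
  *#0 x y x#0 y#0 = combine (#0-bound {x} x#0) (#0-bound {y} y#0)
    where
    combine : EventuallyAwayFrom0 (seq x) → EventuallyAwayFrom0 (seq y) → x *ℝ y # 0ℝ
    combine (δ , δ>0 , M , f) (δ′ , δ′>0 , N , g) = bound-#0 {x *ℝ y}
      ( δ * δ′ , pos*pos⇒pos δ {{δ>0}} δ′ {{δ′>0}} , M ℕ.⊔ N , λ n n≥ →
        *-apart {seq x n} {seq y n} {{δ>0}} {{δ′>0}} (f n (⊔≤₁ n≥)) (g n (⊔≤₂ n≥)))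

  ^#0 : ∀ x → x # 0ℝ → ∀ n → x ^ n # 0ℝ
  ^#0 x x#0 zero    = 1#0
  ^#0 x x#0 (suc n) = *#0 x (x ^ n) x#0 (^#0 x x#0 n)

infix  9 1/ℝ_
infixr 8 _^ℤ_

1/ℝ_ : ℝ≠0 → ℝ≠0
1/ℝ (x , x#0) = recip x x#0 , recip#0 x x#0

_^ℤ_ : ℝ≠0 → ℤ → ℝ≠0
(x , x#0) ^ℤ (+ n)    = x ^ n , ^#0 x x#0 n
(x , x#0) ^ℤ -[1+ n ] = 1/ℝ (x ^ suc n , ^#0 x x#0 (suc n))

-- The superscript (third order) is part of the name, not an exponent.
H⁽³⁾ : (a b c r s t : ℝ) → ℕ → ℝ
H⁽³⁾ a b c r s t 0 = a
H⁽³⁾ a b c r s t 1 = b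
H⁽³⁾ a b c r s t 2 = c
H⁽³⁾ a b c r s t (suc (suc (suc n))) =
  r *ℝ H⁽³⁾ a b c r s t (suc (suc n)) +ℝ s *ℝ H⁽³⁾ a b c r s t (suc n)
    +ℝ t *ℝ H⁽³⁾ a b c r s t n

T⁽³⁾ : ℕ → ℝ
T⁽³⁾ 0 = 0ℝ
T⁽³⁾ 1 = 0ℝ
T⁽³⁾ 2 = 1ℝ
T⁽³⁾ (suc (suc (suc n))) =
  T⁽³⁾ (suc (suc n)) +ℝ fromℕ 3 *ℝ T⁽³⁾ (suc n) +ℝ fromℕ 9 *ℝ T⁽³⁾ n

{-# OPTIONS --safe #-}
-- If S satisfies the recurrence with coefficients 1, s, t, then n ↦ xⁿ S n
-- satisfies the one with coefficients x, s x², t x³. For x = λ, comparing the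
-- first three terms gives λⁿ T⁽³⁾ n = λ² H⁽³⁾ n; for n ≥ 2 cancel λ², and for
-- n = 1 both sides of the theorem vanish.
module Submission where

open import Defs
open import Algebra.Bundles using (CommutativeRing)
import Algebra.Properties.Semiring.Exp as Exp
import Algebra.Solver.Ring.NaturalCoefficients.Default as RingSolver
open import Data.Integer.Base as ℤ using (+_)
open import Data.Nat.Base as ℕ using (ℕ; suc)
open import Data.Product.Base using (_,_; proj₁)
import Relation.Binary.Reasoning.Setoid as SetoidReasoning

module Scaling {c ℓ} (R : CommutativeRing c ℓ) where

  open CommutativeRing R
    renaming (_≈_ to _≋_; refl to ≋-refl; sym to ≋-sym; trans to ≋-trans)
  open Exp semiring renaming (_^_ to _^ᴿ_)
  open RingSolver commutativeSemiring
  open SetoidReasoning setoid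

  *0≋*0 : ∀ y z → y * 0# ≋ z * 0#
  *0≋*0 y z = ≋-trans (zeroʳ y) (≋-sym (zeroʳ z))

  -- Here `v` and `u` act as inverses of `x ^ᴿ 2` and `x ^ᴿ m`: multiplying the last hypothesis by
  -- `v * u` removes the whole power of `x` on the left and leaves only `u` on the right.
  cancel-power : ∀ x {v u y z} m → x ^ᴿ 2 * v ≋ 1# → x ^ᴿ m * u ≋ 1# →
                 x ^ᴿ (2 ℕ.+ m) * y ≋ x ^ᴿ 2 * z → y ≋ u * z
  cancel-power x {v} {u} {y} {z} m x²v≋1 xᵐu≋1 eq = begin
    y                                  ≈⟨ *-identityˡ y ⟨
    1# * y                             ≈⟨ *-congʳ (*-identityˡ 1#) ⟨
    1# * 1# * y                        ≈⟨ *-congʳ (*-cong x²v≋1 xᵐu≋1) ⟨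
    x ^ᴿ 2 * v * (x ^ᴿ m * u) * y
      -- The factors `x :* con 1` follow the unfolding of `x ^ᴿ 2` to `x * (x * 1#)`; `p` keeps
      -- `x ^ᴿ m` as an atom.
      ≈⟨ solve 5 (λ x v p u y →
           x :* (x :* con 1) :* v :* (p :* u) :* y := v :* u :* (x :* (x :* p) :* y))
           ≋-refl x v (x ^ᴿ m) u y ⟩
    v * u * (x ^ᴿ (2 ℕ.+ m) * y)       ≈⟨ *-congˡ eq ⟩
    v * u * (x ^ᴿ 2 * z)
      ≈⟨ solve 4 (λ k v u z → v :* u :* (k :* z) := k :* v :* (u :* z))
           ≋-refl (x ^ᴿ 2) v u z ⟩
    x ^ᴿ 2 * v * (u * z)               ≈⟨ *-congʳ x²v≋1 ⟩
    1# * (u * z)                       ≈⟨ *-identityˡ (u * z) ⟩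
    u * z                              ∎

  module _ (x s t k : Carrier) (S G : ℕ → Carrier)
    (S-rec : ∀ n → S (3 ℕ.+ n) ≋ S (2 ℕ.+ n) + s * S (1 ℕ.+ n) + t * S n)
    (G-rec : ∀ n → G (3 ℕ.+ n) ≋
      x * G (2 ℕ.+ n) + s * x ^ᴿ 2 * G (1 ℕ.+ n) + t * x ^ᴿ 3 * G n)
    (base₀ : x ^ᴿ 0 * S 0 ≋ k * G 0) (base₁ : x ^ᴿ 1 * S 1 ≋ k * G 1)
    (base₂ : x ^ᴿ 2 * S 2 ≋ k * G 2)
    where

    -- Both sides satisfy the same linear recurrence of order three, so agreement at 0, 1 and 2
    -- propagates by induction.
    scaling : ∀ n → x ^ᴿ n * S n ≋ k * G n
    scaling 0 = base₀
    scaling 1 = base₁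
    scaling 2 = base₂
    scaling (suc (suc (suc n))) = begin
      x ^ᴿ (3 ℕ.+ n) * S (3 ℕ.+ n)
        ≈⟨ *-congˡ (S-rec n) ⟩
      x ^ᴿ (3 ℕ.+ n) * (S (2 ℕ.+ n) + s * S (1 ℕ.+ n) + t * S n)
        -- Each term receives the power of `x` that its index calls for; the remaining `x`, `x ^ᴿ 2`
        -- or `x ^ᴿ 3` becomes part of the coefficient.
        ≈⟨ solve 7 (λ x s t p a b c →
             x :* (x :* (x :* p)) :* (a :+ s :* b :+ t :* c) :=
             x :* (x :* (x :* p) :* a) :+ s :* (x :* (x :* con 1)) :* (x :* p :* b)
               :+ t :* (x :* (x :* (x :* con 1))) :* (p :* c))
             ≋-refl x s t (x ^ᴿ n) (S (2 ℕ.+ n)) (S (1 ℕ.+ n)) (S n) ⟩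
      x * (x ^ᴿ (2 ℕ.+ n) * S (2 ℕ.+ n)) + s * x ^ᴿ 2 * (x ^ᴿ (1 ℕ.+ n) * S (1 ℕ.+ n))
        + t * x ^ᴿ 3 * (x ^ᴿ n * S n)
        ≈⟨ +-cong (+-cong (*-congˡ (scaling (suc (suc n)))) (*-congˡ (scaling (suc n))))
             (*-congˡ (scaling n)) ⟩
      x * (k * G (2 ℕ.+ n)) + s * x ^ᴿ 2 * (k * G (1 ℕ.+ n)) + t * x ^ᴿ 3 * (k * G n)
        ≈⟨ solve 7 (λ x u v k a b c →
             x :* (k :* a) :+ u :* (k :* b) :+ v :* (k :* c) :=
             k :* (x :* a :+ u :* b :+ v :* c))
             ≋-refl x (s * x ^ᴿ 2) (t * x ^ᴿ 3) k (G (2 ℕ.+ n)) (G (1 ℕ.+ n)) (G n) ⟩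
      k * (x * G (2 ℕ.+ n) + s * x ^ᴿ 2 * G (1 ℕ.+ n) + t * x ^ᴿ 3 * G n)
        ≈⟨ *-congˡ (G-rec n) ⟨
      k * G (3 ℕ.+ n) ∎

open CommutativeRing ℝ-commutativeRing using (zeroʳ)
open Scaling ℝ-commutativeRing

H₀₀₁ : ℝ → ℕ → ℝ
H₀₀₁ x = H⁽³⁾ 0ℝ 0ℝ 1ℝ x (fromℕ 3 *ℝ x ^ 2) (fromℕ 9 *ℝ x ^ 3)

^*T≈²*H : ∀ x n → x ^ n *ℝ T⁽³⁾ n ≈ x ^ 2 *ℝ H₀₀₁ x n
^*T≈²*H x = scaling x (fromℕ 3) (fromℕ 9) (x ^ 2) T⁽³⁾ (H₀₀₁ x)
  -- Both recurrences hold by definition. At 0 and 1 both sequences vanish; at 2 both equal `1ℝ`,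
  -- which forces the constant `x ^ 2`.
  (λ n → ≈-refl {T⁽³⁾ (3 ℕ.+ n)}) (λ n → ≈-refl {H₀₀₁ x (3 ℕ.+ n)})
  (*0≋*0 (x ^ 0) (x ^ 2)) (*0≋*0 (x ^ 1) (x ^ 2)) (≈-refl {x ^ 2 *ℝ 1ℝ})

proposition3p3 : (lam : ℝ) (lam#0 : lam # 0ℝ) (n : ℕ) → n ℕ.≥ 1 →
    T⁽³⁾ n ≈ proj₁ (1/ℝ ((lam , lam#0) ^ℤ (+ n ℤ.- + 2)))
    *ℝ H⁽³⁾ 0ℝ 0ℝ 1ℝ lam (fromℕ 3 *ℝ lam ^ 2) (fromℕ 9 *ℝ lam ^ 3) n
proposition3p3 lam lam#0 1 _ =
  -- The exponent is -1 here, but the Horadam factor is `0ℝ`, so the value of the power does not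
  -- matter.
  ≈-sym {1/lam⁻¹ *ℝ 0ℝ} {0ℝ} (zeroʳ 1/lam⁻¹)
  where
  1/lam⁻¹ = proj₁ (1/ℝ ((lam , lam#0) ^ℤ (+ 1 ℤ.- + 2)))
proposition3p3 lam lam#0 (suc (suc m)) _ =
  -- The exponent `+ (2 ℕ.+ m) ℤ.- + 2` computes to `+ m`, so the prefactor is `recip (lam ^ m)` by
  -- definition.
  cancel-power lam {recip (lam ^ 2) (^#0 lam lam#0 2)} {recip (lam ^ m) (^#0 lam lam#0 m)}
    {T⁽³⁾ (2 ℕ.+ m)} {H₀₀₁ lam (2 ℕ.+ m)} m
    (*-recipʳ (lam ^ 2) (^#0 lam lam#0 2)) (*-recipʳ (lam ^ m) (^#0 lam lam#0 m))
    (^*T≈²*H lam (2 ℕ.+ m))
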